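{- Every strongly extensive digraph is Cantor, i.e. Cantor's theorem holds in it.
   Context: A digraph is $D=\langle V,E\rangle$ with $V$ a nonempty set and $E\subseteq V\times V$; $uEv$ means $\langle u,v\rangle\in E$. $N(u)=\{v\in V: vEu\}$ is the set of in-neighbors of $u$; elements of $N(u)$ are the $D$-elements of $u$. $D$ is strongly extensive if for every vertex $u\in V$ and every set $A\subseteq N(u)$ there exists a vertex $v\in V$ such that $N(v)=A$. For vertices of $D$: $u$ is a $D$-subset of $v$ ($u\subset_D v$) if $N(u)\subseteq N(v)$; $u$ is the singleton $\{v\}_D$ if $u$ is the only vertex with $N(u)=\{v\}$; $u$ is the doubleton $\{v,w\}_D$ if $u$ is the only vertex with $N(u)=\{v,w\}$; $u$ is an ordered pair $\langle v,w\rangle_D$ if $u=\{\{v\}_D,\{v,w\}_D\}_D$ (i.e. there are vertices $s,t$ such that $s$ is the singleton $\{v\}_D$, $t$ is the doubleton $\{v,w\}_D$ and $u$ is the doubleton $\{s,t\}_D$). $u$ is a $D$-relation from $v$ to $P(v)$ if every $D$-element of $u$ is an ordered pair $\langle w,w'\rangle_D$ with $wEv$ and $w'\subset_D v$. $u$ is a $D$-function from $v$ to $P(v)$ if it is a $D$-relation from $v$ to $P(v)$ and for every $D$-element $w$ of $v$ there is exactly one ordered pair $\langle w,w'\rangle_D$ that is a $D$-element of $u$. $u$ is a $D$-surjection from $v$ to $P(v)$ if it is a $D$-function from $v$ to $P(v)$ and for every $w'\subset_D v$ there is at least one ordered pair $\langle w,w'\rangle_D$ that is a $D$-element of $u$.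 Cantor's theorem holds in $D$ ($D$ is Cantor) if for no vertex $u\in V$ there exists a vertex $v\in V$ that is a $D$-surjection from $u$ to $P(u)$. -}

module Defs where

open import Data.Product using (_×_; ∃; ∃₂; ∃!)
open import Level using (Level; _⊔_; suc)
open import Relation.Binary.Core using (Rel)
open import Relation.Binary.PropositionalEquality using (_≡_)
open import Relation.Nullary using (¬_)
open import Relation.Unary using (Pred; _⊆_; _≐_; _∪_; ｛_｝)

private
  variable
    a e : Level

record Digraph (a e : Level) : Set (suc (a ⊔ e)) where
  infix 4 _E_
  field
    V        : Set a
    _E_      : Rel V e
    nonempty : V

module _ (D : Digraph a e) where
  open Digraph D

  N : V → Pred V e
  N u v = v E u

  -- Sets of vertices are predicates up to extensional equality _≐_.  The level
  -- a ⊔ e is closed under quantification over V, equality on V and the relation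
  -- _E_, so every set of vertices definable from these is among the A.
  StronglyExtensive : Set (suc (a ⊔ e))
  StronglyExtensive =
    ∀ (u : V) (A : Pred V (a ⊔ e)) → A ⊆ N u → ∃ λ v → N v ≐ A

  Subset : V → V → Set (a ⊔ e)
  Subset u v = N u ⊆ N v

  OnlyVertexWith : V → Pred V a → Set (a ⊔ e)
  OnlyVertexWith u A = N u ≐ A × (∀ u′ → N u′ ≐ A → u′ ≡ u)

  IsSingleton : V → V → Set (a ⊔ e)
  IsSingleton u v = OnlyVertexWith u ｛ v ｝

  IsDoubleton : V → V → V → Set (a ⊔ e)
  IsDoubleton u v w = OnlyVertexWith u (｛ v ｝ ∪ ｛ w ｝)

  -- IsOrderedPair u v w: the vertex u is ⟨ v , w ⟩ in D.
  IsOrderedPair : V → V → V → Set (a ⊔ e)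
  IsOrderedPair u v w =
    ∃₂ λ s t → IsSingleton s v × IsDoubleton t v w × IsDoubleton u s t

  -- In the next three definitions u is the relation (function, surjection)
  -- from v to P(v).
  IsRelation : V → V → Set (a ⊔ e)
  IsRelation u v =
    ∀ p → p E u → ∃₂ λ w w′ → IsOrderedPair p w w′ × w E v × Subset w′ v

  IsFunction : V → V → Set (a ⊔ e)
  IsFunction u v =
    IsRelation u v ×
    (∀ w → w E v → ∃! _≡_ λ p → (∃ λ w′ → IsOrderedPair p w w′) × p E u)

  IsSurjection : V → V → Set (a ⊔ e)
  IsSurjection u v =
    IsFunction u v ×
    (∀ w′ → Subset w′ v → ∃ λ p → (∃ λ w → IsOrderedPair p w w′) × p E u)

  Cantor : Set (a ⊔ e)
  Cantor = ∀ u → ¬ (∃ λ v → IsSurjection v u)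

{-# OPTIONS --safe #-}

-- Suppose f is a surjection from u to P(u).  Strong extensivity yields a vertex
-- d whose D-elements are the w E u with some ⟨ w , w′ ⟩ in f such that w is not
-- a D-element of w′.  Surjectivity gives w with ⟨ w , d ⟩ in f; as f is
-- single-valued and ordered pairs determine their coordinates, w E d holds if
-- and only if it fails.
module Submission where

open import Defs
open import Data.Product using (_×_; _,_; ∃₂; proj₁; proj₂)
open import Data.Sum using (inj₁; inj₂)
open import Level using (Level; _⊔_)
open import Relation.Binary.PropositionalEquality using (_≡_; refl; sym; trans)
open import Relation.Nullary using (¬_)
open import Relation.Unary using (Pred; _≐_; _∪_; ｛_｝)
open import Relation.Unary.Properties using (≐-sym; ≐-trans)

private
  variable
    a e : Level

module _ {A : Set a} where

  -- Membership itself decides the case: locating `y` and `z` in the opposite doubletons makes them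
  -- equal to each other or both equal to `x`.
  doubleton-cancelˡ : ∀ {x y z : A} → ｛ x ｝ ∪ ｛ y ｝ ≐ ｛ x ｝ ∪ ｛ z ｝ → y ≡ z
  doubleton-cancelˡ (⊆₁ , ⊆₂) with ⊆₁ (inj₂ refl) | ⊆₂ (inj₂ refl)
  ... | inj₂ z≡y | _        = sym z≡y
  ... | inj₁ _   | inj₂ y≡z = y≡z
  ... | inj₁ x≡y | inj₁ x≡z = trans (sym x≡y) x≡z

module _ (D : Digraph a e) where
  open Digraph D

  IsDoubleton-cancelˡ : ∀ {u v w w′} →
    IsDoubleton D u v w → IsDoubleton D u v w′ → w ≡ w′
  IsDoubleton-cancelˡ (N≐ , _) (N≐′ , _) =
    doubleton-cancelˡ (≐-trans (≐-sym N≐) N≐′)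

  IsOrderedPair-injectiveˡ : ∀ {p v w v′ w′} →
    IsOrderedPair D p v w → IsOrderedPair D p v′ w′ → v ≡ v′
  IsOrderedPair-injectiveˡ
    (s , t , (s≐ , _) , (t≐ , _) , (p≐ , _))
    (s′ , t′ , (s′≐ , _) , _ , (p≐′ , _))
    -- The singleton `s′` lies in `p`, so it is `s` or `t`; if it is `t`, the pair is degenerate,
    -- but `v` still lies in it.
    with proj₁ p≐ (proj₂ p≐′ (inj₁ refl))
  ... | inj₁ refl = proj₁ s≐ (proj₂ s′≐ refl)
  ... | inj₂ refl = sym (proj₁ s′≐ (proj₂ t≐ (inj₁ refl)))

  IsOrderedPair-injectiveʳ : ∀ {p v w w′} →
    IsOrderedPair D p v w → IsOrderedPair D p v w′ → w ≡ w′
  IsOrderedPair-injectiveʳ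
    (s , t , (_ , s!) , t-v,w , p-s,t)
    (s′ , t′ , (s′≐ , _) , t′-v,w′ , p-s′,t′)
    -- Both singletons are of `v`, so they are one vertex; cancelling it in `p` leaves `t ≡ t′`.
    with refl ← s! s′ s′≐
    with refl ← IsDoubleton-cancelˡ p-s,t p-s′,t′
    = IsDoubleton-cancelˡ t-v,w t′-v,w′

  Diagonal : V → V → Pred V (a ⊔ e)
  Diagonal f u w =
    w E u × ∃₂ λ p w′ → IsOrderedPair D p w w′ × p E f × ¬ (w E w′)

  -- `IsFunction` asserts uniqueness of the pair vertex over `w`, not of the value, so `p` and `q`
  -- are identified first.
  IsFunction-functional : ∀ {f u p q w x y} → IsFunction D f u → w E u →
    IsOrderedPair D p w x → p E f → IsOrderedPair D q w y → q E f → x ≡ y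
  IsFunction-functional (_ , f!) wEu p-w,x pEf q-w,y qEf
    with _ , _ , unique ← f! _ wEu
    with refl ← unique ((_ , p-w,x) , pEf)
    with refl ← unique ((_ , q-w,y) , qEf)
    = IsOrderedPair-injectiveʳ p-w,x q-w,y

  -- `IsRelation` presents `p` as a pair with coordinates of its own; the first one must be `w`.
  IsRelation-domain : ∀ {f u p w x} → IsRelation D f u →
    IsOrderedPair D p w x → p E f → w E u
  IsRelation-domain f-rel p-w,x pEf
    with _ , _ , p-w′,x′ , w′Eu , _ ← f-rel _ pEf
    with refl ← IsOrderedPair-injectiveˡ p-w,x p-w′,x′
    = w′Eu

mainTheorem3 : ∀ {a e : Level} (D : Digraph a e) → StronglyExtensive D → Cantor D
mainTheorem3 D ext u (f , f-fun , f-onto)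
  with d , d⊆ , ⊆d ← ext u (Diagonal D f u) proj₁
  with p , (w , p-w,d) , pEf ← f-onto d (λ xEd → proj₁ (d⊆ xEd))
  = w∉d (⊆d (wEu , p , d , p-w,d , pEf , w∉d))
  where
  open Digraph D

  wEu : w E u
  wEu = IsRelation-domain D (proj₁ f-fun) p-w,d pEf

  w∉d : ¬ (w E d)
  w∉d wEd
    -- The value `y` that witnesses `w E d` must be `d` itself, so `w∉y` contradicts `wEd`.
    with _ , _ , _ , q-w,y , qEf , w∉y ← d⊆ wEd
    with refl ← IsFunction-functional D f-fun wEu p-w,d pEf q-w,y qEf
    = w∉y wEd
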